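{- Let $b\geq 3$ be an integer and $W\subsetneq\{0,1,\ldots,b-1\}$ with $|W|\geq 2$. If $\mathcal{S}=\{q_1,\ldots,q_v\}$ is any finite set of prime numbers not dividing $b$, then there are only finitely many rational numbers $r/s$ in $C_{b,W}$ with $s$ consisting only of prime factors in $\mathcal{S}$. In particular, for a rational number $p/q$ with $(b,q)=1$, only finitely many of its positive integer powers $(p/q)^n$ (counted as distinct real numbers) lie in $C_{b,W}$. Moreover, $C_{b,W}$ contains at most finitely many rational numbers $p/q$ where $q$ is a safe prime, i.e. $q$ and $(q-1)/2$ are both prime numbers.
   Context: For an integer $b\geq 3$ and a digit set $W\subseteq\{0,1,\ldots,b-1\}$ with $2\leq|W|\leq b-1$, the missing digit Cantor set $C_{b,W}$ is the set of real numbers in $[0,1]$ having a base $b$ expansion $\sum_{j\geq1}w_jb^{ -j}$ with all digits $w_j\in W$. Finiteness refers to finiteness of a set of real numbers. -}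

module Defs where

open import Algebra.Definitions.RawSemiring using (_^_)
open import Data.Fin.Base using (Fin; toℕ)
open import Data.Fin.Subset using (Subset) renaming (_∈_ to _∈ˢ_)
open import Data.Integer.Base using (+_)
open import Data.List.Base using (List)
open import Data.List.Membership.Propositional using (_∈_)
open import Data.Nat.Base as ℕ using (ℕ; zero; suc; NonZero)
open import Data.Nat.Divisibility using (_∣_)
open import Data.Nat.Primality using (Prime)
open import Data.Nat.Properties using (m^n≢0)
open import Data.Product.Base using (∃-syntax; _×_)
open import Data.Rational.Base using (ℚ; 0ℚ; _+_; _-_; _/_; _<_; ∣_∣; +-*-rawSemiring)
open import Level using (0ℓ)
open import Relation.Unary using (Pred)

infixr 8 _^ℚ_
_^ℚ_ : ℚ → ℕ → ℚ
_^ℚ_ = _^_ +-*-rawSemiring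

ConvergesTo : (ℕ → ℚ) → ℚ → Set
ConvergesTo u x = ∀ ε → 0ℚ < ε → ∃[ N ] (∀ n → N ℕ.≤ n → ∣ u n - x ∣ < ε)

-- Digits are indexed from 0, so w j is the coefficient of b^{-(j+1)}.
partialSum : (b : ℕ) .{{_ : NonZero b}} → (ℕ → Fin b) → ℕ → ℚ
partialSum b w zero    = 0ℚ
partialSum b w (suc n) =
  partialSum b w n + (_/_ (+ toℕ (w n)) (b ℕ.^ suc n) {{m^n≢0 b (suc n)}})

-- The rational points of the missing digit Cantor set C_{b,W}: the real number
-- Σ_{j≥1} w_j b^{-j} equals the rational x exactly when the partial sums
-- (which are rational) converge to x, so no type of real numbers is needed.
-- Expansions ending in repeated digits 0 or b-1 are allowed.
C : (b : ℕ) .{{_ : NonZero b}} → Subset b → Pred ℚ 0ℓ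
C b W x = ∃[ w ] ((∀ j → w j ∈ˢ W) × ConvergesTo (partialSum b w) x)

-- A predicate holds for finitely many elements when some list contains them
-- all; the list may have repetitions and may contain further elements.
FinitelyMany : {A : Set} → Pred A 0ℓ → Set
FinitelyMany {A} P = ∃[ xs ] (∀ (x : A) → P x → x ∈ xs)

OnlyPrimeFactorsIn : List ℕ → ℕ → Set
OnlyPrimeFactorsIn S s = ∀ p → Prime p → p ∣ s → p ∈ S

-- The division is truncated, which is harmless: it is exact for odd q, and
-- q = 2 is excluded because (2 ∸ 1) / 2 = 0 is not prime.
SafePrime : ℕ → Set
SafePrime q = Prime q × Prime ((q ℕ.∸ 1) ℕ./ 2)

{-# OPTIONS --safe #-}
-- Put a = b - 1 and let x = r/s in C_{b,W} be in lowest terms with s coprime to b.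
-- Shifting the expansion of x by j digits gives m_j/s with 0 <= m_j <= s and
-- m_j = b^j r mod s; if b^n > s, then m_j is determined by the n digits from
-- position j on. These digits avoid one value, so there are at most a^n such
-- windows and b^d = 1 mod s for some 1 <= d <= a^n. If also s <= K d for some K
-- independent of x, then choosing n with b^n <= b s bounds (b/a)^n, hence n and s.
--
-- For s with prime factors in S, let P be the product of S and take D with
-- b^D = 1 + K and P^2 | K; lifting the exponent turns s | (1+K)^d - 1 into
-- s | K d. Powers of p/q are such fractions with S the prime factors of q. For a
-- safe prime q = 2h + 1, Fermat's little theorem gives b^(2h) = 1 mod q, and h
-- being prime forces d >= h or q | b^2 - 1.
module Submission where

open import Defs
open import Data.Fin.Subset using (Subset; ⊤; _⊂_; ∣_∣)
open import Data.Integer.Base using (ℤ)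
open import Data.List.Base using (List)
open import Data.List.Relation.Unary.All using (All)
open import Data.Nat.Base using (ℕ; NonZero; _≤_)
open import Data.Nat.Coprimality using (Coprime)
open import Data.Nat.Divisibility using (_∤_)
open import Data.Nat.Primality using (Prime)
open import Data.Product.Base using (Σ-syntax; ∃-syntax; _×_)
open import Data.Rational.Base using (ℚ; _/_)
open import Relation.Binary.PropositionalEquality using (_≡_)

import Algebra.Definitions.RawSemiring as RawSemiring
open import Data.Empty using (⊥)
open import Data.Fin.Base as Fin using (Fin; toℕ; fromℕ; fromℕ<; inject₁; funToFin; finToFun; punchOut)
open import Data.Fin.Properties
  using ( pigeonhole; toℕ-fromℕ; toℕ-fromℕ<; toℕ-inject₁; toℕ<n; toℕ≤pred[n]
        ; finToFun-funToFin; punchOut-injective)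
open import Data.Fin.Subset using () renaming (_∈_ to _∈ˢ_; _∉_ to _∉ˢ_)
open import Data.Integer.Base as ℤ using (+_; -[1+_]; +≤+)
import Data.Integer.GCD as ℤ-gcd
import Data.Integer.Properties as ℤ
open import Data.List.Base using ([]; _∷_; upTo; cartesianProductWith)
open import Data.List.Membership.Propositional using (_∈_)
open import Data.List.Membership.Propositional.Properties using (∈-cartesianProductWith⁺; ∈-upTo⁺)
open import Data.List.Relation.Unary.All as All using ([]; _∷_)
open import Data.Nat.Base as ℕ hiding (_/_)
open import Data.Nat.Combinatorics using (nCn≡1; k![n∸k]!∣n!; nCk≡n!/k![n-k]!)
  renaming (_C_ to infixl 6.5 _choose_)
open import Data.Nat.Coprimality as Coprimality using (coprime-divisor)
open import Data.Nat.Divisibility hiding (_∤_)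
open import Data.Nat.DivMod using (m≡m%n+[m/n]*n; m%n<n)
open import Data.Nat.GCD using (gcd; gcd[m,n]∣m; gcd[m,n]∣n; module Bézout)
open import Data.Nat.Induction using (<-rec)
open import Data.Nat.ListAction using (product)
open import Data.Nat.ListAction.Properties using (∈⇒∣product)
open import Data.Nat.Primality
  using (euclidsLemma; prime⇒irreducible; prime[2]; ¬prime[0]; ¬prime[1]; productOfPrimes≢0)
open import Data.Nat.Primality.Factorisation
  using (factorise; factorisationHasAllPrimeFactors)
open import Data.Nat.Properties
open import Data.Nat.Tactic.RingSolver using (solve-∀)
open import Data.Product.Base using (_,_; proj₁; proj₂)
open import Data.Rational.Base as ℚ using (mkℚ; 0ℚ; 1ℚ; toℚᵘ; ↧ₙ_)
import Data.Rational.Properties as ℚ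
open import Data.Rational.Unnormalised.Base as ℚᵘ using (mkℚᵘ; *≡*; *≤*)
import Data.Rational.Unnormalised.Properties as ℚᵘ
open import Data.Sum.Base using (inj₁; inj₂)
open import Data.Vec.Functional using (Vector; tail; init; last)
open import Function.Base using (_∘_; case_of_)
open import Relation.Binary.PropositionalEquality
  using (_≢_; refl; sym; trans; cong; cong₂; subst; subst₂; module ≡-Reasoning)
open import Relation.Nullary using (yes; no; contradiction)
open import Relation.Unary using (Pred)
open import Level using (0ℓ)
open import Algebra.Properties.CommutativeSemiring.Binomial +-*-commutativeSemiring
  using (binomialTerm) renaming (theorem to binomial-theorem)
open import Algebra.Properties.Group ℚ.+-0-group using (⁻¹-anti-homo-//)
open import Algebra.Properties.Monoid.Sum +-0-monoid using (sum; sum-init-last)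

-- Congruence to 1 and multiplicative orders.

infix 4 _≡1[mod_]
-- The quotient is a natural number, so `x` is also forced to be positive and no subtraction occurs.
_≡1[mod_] : ℕ → ℕ → Set
x ≡1[mod s ] = ∃[ k ] x ≡ 1 + k * s

≡1-* : ∀ {s x y} → x ≡1[mod s ] → y ≡1[mod s ] → x * y ≡1[mod s ]
≡1-* {s} (k , refl) (l , refl) = k + l + k * l * s , expand k l s
  where
  expand : ∀ k l s → (1 + k * s) * (1 + l * s) ≡ 1 + (k + l + k * l * s) * s
  expand = solve-∀

≡1-^ : ∀ {s x} n → x ≡1[mod s ] → x ^ n ≡1[mod s ]
≡1-^ zero    _   = 0 , refl
≡1-^ (suc n) x≡1 = ≡1-* x≡1 (≡1-^ n x≡1)

coprime-* : ∀ {s m n} → Coprime s m → Coprime s n → Coprime s (m * n)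
coprime-* s⊥m s⊥n (d∣s , d∣mn) =
  s⊥n (d∣s , coprime-divisor (λ (e∣d , e∣m) → s⊥m (∣-trans e∣d d∣s , e∣m)) d∣mn)

coprime-^ : ∀ {s m} n → Coprime s m → Coprime s (m ^ n)
coprime-^ zero    _   = Coprimality.sym (Coprimality.1-coprimeTo _)
coprime-^ (suc n) s⊥m = coprime-* s⊥m (coprime-^ n s⊥m)

∣m+n∣n⇒∣m : ∀ {d m n} → d ∣ m + n → d ∣ n → d ∣ m
∣m+n∣n⇒∣m {d} {m} {n} d∣m+n d∣n = ∣m+n∣m⇒∣n (subst (d ∣_) (+-comm m n) d∣m+n) d∣n

coprime-1+* : ∀ k m → Coprime (1 + k * m) m
coprime-1+* k m (d∣1+km , d∣m) =
  ∣1⇒≡1 (∣m+n∣n⇒∣m d∣1+km (∣n⇒∣m*n k d∣m))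

-- Multiples of `s` pad both sides so that the congruence `x y ≡ x` stays in ℕ. Subtracting `x`
-- leaves `s ∣ x (y - 1)`, and `x` is invertible modulo `s`.
≡1-cancelˡ : ∀ {s x y} k l .{{_ : NonZero y}} → Coprime s x →
             x * y + k * s ≡ x + l * s → y ≡1[mod s ]
≡1-cancelˡ {s} {x} {suc y} k l s⊥x eq = quotient s∣y , cong suc (m∣n⇒n≡quotient*m s∣y)
  where
  regroup : ∀ x y k s → x + (k * s + x * y) ≡ x * suc y + k * s
  regroup = solve-∀
  s∣y : s ∣ y
  s∣y = coprime-divisor s⊥x (∣m+n∣m⇒∣n {m = k * s}
    (subst (s ∣_) (sym (+-cancelˡ-≡ x _ _ (trans (regroup x y k s) eq))) (n∣m*n l))
    (n∣m*n k))

≡1⇒< : ∀ {s x} → 1 < x → x ≡1[mod s ] → s < x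
≡1⇒< (s≤s ()) (zero , refl)
≡1⇒< {s} 1<x (suc k , refl) = s≤s (m≤m+n s (k * s))

-- Two of the powers `b ^ 0`, ..., `b ^ m` share a residue modulo `m`; cancelling the smaller one
-- leaves the difference of the exponents.
power≡1 : ∀ {b m} .{{_ : NonZero b}} .{{_ : NonZero m}} → Coprime m b →
          ∃[ d ] 1 ≤ d × b ^ d ≡1[mod m ]
power≡1 {b} {m} m⊥b with pigeonhole (n<1+n m) (λ i → fromℕ< (m%n<n (b ^ toℕ i) m))
... | i , j , i<j , eq = toℕ j ∸ toℕ i , m<n⇒0<n∸m i<j ,
  ≡1-cancelˡ (b ^ toℕ i ℕ./ m) (b ^ toℕ j ℕ./ m) {{m^n≢0 b (toℕ j ∸ toℕ i)}} (coprime-^ (toℕ i) m⊥b) (begin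
    b ^ toℕ i * b ^ (toℕ j ∸ toℕ i) + bi/m * m ≡⟨ cong (_+ bi/m * m) (^-distribˡ-+-* b (toℕ i) _) ⟨
    b ^ (toℕ i + (toℕ j ∸ toℕ i)) + bi/m * m ≡⟨ cong (λ n → b ^ n + bi/m * m) (m+[n∸m]≡n (<⇒≤ i<j)) ⟩
    b ^ toℕ j + bi/m * m ≡⟨ cong (_+ bi/m * m) (m≡m%n+[m/n]*n (b ^ toℕ j) m) ⟩
    b ^ toℕ j % m + bj/m * m + bi/m * m ≡⟨ cong (λ r → r + bj/m * m + bi/m * m) r≡ ⟨
    b ^ toℕ i % m + bj/m * m + bi/m * m ≡⟨ swap (b ^ toℕ i % m) (bj/m * m) (bi/m * m) ⟩
    b ^ toℕ i % m + bi/m * m + bj/m * m ≡⟨ cong (_+ bj/m * m) (m≡m%n+[m/n]*n (b ^ toℕ i) m) ⟨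
    b ^ toℕ i + bj/m * m ∎)
  where
  open ≡-Reasoning
  bi/m = b ^ toℕ i ℕ./ m
  bj/m = b ^ toℕ j ℕ./ m
  swap : ∀ x y z → x + y + z ≡ x + z + y
  swap = solve-∀
  r≡ : b ^ toℕ i % m ≡ b ^ toℕ j % m
  r≡ = trans (sym (toℕ-fromℕ< _)) (trans (cong toℕ eq) (toℕ-fromℕ< _))

-- Lifting the exponent.

-- The factor `k` is kept outside so that the cofactor `n + l * k` can be compared with `n` modulo
-- divisors of `k`.
[1+k]^n-mod-k² : ∀ k n → ∃[ l ] (1 + k) ^ n ≡ 1 + k * (n + l * k)
[1+k]^n-mod-k² k zero = 0 , cong suc (sym (*-zeroʳ k))
[1+k]^n-mod-k² k (suc n) with l , eq ← [1+k]^n-mod-k² k n =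
  l + n + l * k , trans (cong ((1 + k) *_) eq) (expand k n l)
  where
  expand : ∀ k n l → (1 + k) * (1 + k * (n + l * k)) ≡ 1 + k * (suc n + (l + n + l * k) * k)
  expand = solve-∀

≡1⇒∣ : ∀ {s x} → 1 + x ≡1[mod s ] → s ∣ x
≡1⇒∣ (k , eq) = divides k (suc-injective eq)

-- Dividing d by g = gcd d p replaces k by k g (1 + p u), whose last factor is
-- invertible modulo s; at g = 1 the binomial expansion modulo k² finishes.
-- The hypothesis p² ∣ k rather than p ∣ k is what makes that factor ≡ 1 mod p.
lifting-the-exponent : ∀ {s p} → (∀ u → Coprime u p → Coprime s u) →
          ∀ d k → p * p ∣ k → (1 + k) ^ d ≡1[mod s ] → s ∣ k * d
lifting-the-exponent {s} {p} s⊥ = <-rec _ step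
  where
  step : ∀ d → (∀ {d′} → d′ < d → ∀ k → p * p ∣ k → (1 + k) ^ d′ ≡1[mod s ] → s ∣ k * d′) →
         ∀ k → p * p ∣ k → (1 + k) ^ d ≡1[mod s ] → s ∣ k * d
  step zero _ k _ _ = subst (s ∣_) (sym (*-zeroʳ k)) (s ∣0)
  step d@(suc _) rec k p²∣k@(divides c k≡cp²) pow
    with gcd d p in gcd≡ | gcd[m,n]∣m d p | gcd[m,n]∣n d p
  ... | 0 | 0∣d | _ with () ← 0∣⇒≡0 0∣d
  ... | 1 | _ | _ with l , eq ← [1+k]^n-mod-k² k d =
    ∣m⇒∣m*n d (coprime-divisor (s⊥ _ d+lk⊥p)
      (subst (s ∣_) (*-comm k _) (≡1⇒∣ (subst (_≡1[mod s ]) eq pow))))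
    where
    p∣lk : p ∣ l * k
    p∣lk = ∣n⇒∣m*n l (∣-trans (m∣m*n p) p²∣k)
    d+lk⊥p : Coprime (d + l * k) p
    d+lk⊥p (e∣d+lk , e∣p) = Coprimality.gcd≡1⇒coprime gcd≡
      (∣m+n∣n⇒∣m e∣d+lk (∣-trans e∣p p∣lk) , e∣p)
  ... | g@(suc (suc _)) | divides d′ d≡d′g | divides h p≡hg
    with l , eq ← [1+k]^n-mod-k² k g =
    coprime-divisor (s⊥ _ (coprime-1+* (l * c * h) p))
      (subst (s ∣_) regroup (rec d′<d (k * (g + l * k)) (∣m⇒∣m*n _ p²∣k) (subst (_≡1[mod s ]) power pow)))
    where
    open ≡-Reasoning
    d′<d : d′ < d
    d′<d = quotient-< (divides d′ d≡d′g)
    power : (1 + k) ^ d ≡ (1 + k * (g + l * k)) ^ d′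
    power = begin
      (1 + k) ^ d ≡⟨ cong ((1 + k) ^_) (trans d≡d′g (*-comm d′ g)) ⟩
      (1 + k) ^ (g * d′) ≡⟨ ^-*-assoc (1 + k) g d′ ⟨
      ((1 + k) ^ g) ^ d′ ≡⟨ cong (_^ d′) eq ⟩
      (1 + k * (g + l * k)) ^ d′ ∎
    factor : ∀ k g l c h p d′ →
      k * (g + l * (c * (h * g * p))) * d′ ≡ (1 + l * c * h * p) * (k * (d′ * g))
    factor = solve-∀
    regroup : k * (g + l * k) * d′ ≡ (1 + l * c * h * p) * (k * d)
    regroup = begin
      k * (g + l * k) * d′ ≡⟨ cong (λ x → k * (g + l * x) * d′) k≡cp² ⟩
      k * (g + l * (c * (p * p))) * d′ ≡⟨ cong (λ x → k * (g + l * (c * (x * p))) * d′) p≡hg ⟩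
      k * (g + l * (c * (h * g * p))) * d′ ≡⟨ factor k g l c h p d′ ⟩
      (1 + l * c * h * p) * (k * (d′ * g)) ≡⟨ cong (λ x → (1 + l * c * h * p) * (k * x)) d≡d′g ⟨
      (1 + l * c * h * p) * (k * d) ∎

-- Growth of powers.

-- Induction on `s`: the exponent stays until `1 + s` reaches `b ^ n`, and then rises by one.
<-power : ∀ b s .{{_ : NonZero s}} → 1 < b → ∃[ n ] s < b ^ n × b ^ n ≤ b * s
<-power b 1 1<b = 1 , subst (1 <_) (sym (*-identityʳ b)) 1<b , ≤-refl
<-power b (suc s@(suc _)) 1<b with n , s<bⁿ , bⁿ≤bs ← <-power b s 1<b | m≤n⇒m<n∨m≡n s<bⁿ
... | inj₁ 1+s<bⁿ = n , 1+s<bⁿ , ≤-trans bⁿ≤bs (*-monoʳ-≤ b (n≤1+n s))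
... | inj₂ 1+s≡bⁿ = suc n , subst₂ _<_ refl (trans (*-comm _ b) (cong (b *_) 1+s≡bⁿ)) (m<m*n (suc s) b 1<b) ,
                    ≤-reflexive (cong (b *_) (sym 1+s≡bⁿ))

-- Bernoulli's inequality (1 + 1/a)^n >= 1 + n/a, multiplied by a^(n+1).
bernoulli : ∀ a n → a ^ n * (a + n) ≤ a * (1 + a) ^ n
bernoulli a zero    = ≤-reflexive (trans (+-identityʳ _) (trans (+-identityʳ a) (sym (*-identityʳ a))))
bernoulli a (suc n) = begin
  a * a ^ n * (a + suc n)         ≤⟨ m≤m+n _ (a ^ n * n) ⟩
  a * a ^ n * (a + suc n) + a ^ n * n ≡⟨ expand a (a ^ n) n ⟩
  (1 + a) * (a ^ n * (a + n))     ≤⟨ *-monoʳ-≤ (1 + a) (bernoulli a n) ⟩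
  (1 + a) * (a * (1 + a) ^ n)     ≡⟨ swap (1 + a) a ((1 + a) ^ n) ⟩
  a * ((1 + a) * (1 + a) ^ n)     ∎
  where
  open ≤-Reasoning
  expand : ∀ a x n → a * x * (a + suc n) + x * n ≡ (1 + a) * (x * (a + n))
  expand = solve-∀
  swap : ∀ x y z → x * (y * z) ≡ y * (x * z)
  swap = solve-∀

-- Fermat's little theorem from the binomial theorem.

private
  open RawSemiring +-*-rawSemiring using () renaming (_^_ to _^′_; _×_ to _×′_)

  ^′≡^ : ∀ x n → x ^′ n ≡ x ^ n
  ^′≡^ x zero    = refl
  ^′≡^ x (suc n) = cong (x *_) (^′≡^ x n)

  ×′≡* : ∀ n x → n ×′ x ≡ n * x
  ×′≡* zero    x = refl
  ×′≡* (suc n) x = cong (_+_ x) (×′≡* n x)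

∣-sum : ∀ {d n} (t : Vector ℕ n) → (∀ i → d ∣ t i) → d ∣ sum t
∣-sum {n = zero}  t d∣t = _ ∣0
∣-sum {n = suc n} t d∣t = ∣m∣n⇒∣m+n (d∣t Fin.zero) (∣-sum (tail t) (λ i → d∣t (Fin.suc i)))

prime∤! : ∀ {p n} → Prime p → n < p → p ∤ n !
prime∤! {p} {zero} p-prime _ p∣1 = ¬prime[1] (subst Prime (∣1⇒≡1 p∣1) p-prime)
prime∤! {p} {suc n} p-prime n<p p∣n! with euclidsLemma (suc n) (n !) p-prime p∣n!
... | inj₁ p∣1+n = >⇒∤ n<p p∣1+n
... | inj₂ p∣n!  = prime∤! p-prime (<-trans (n<1+n n) n<p) p∣n!

-- `p` divides `p !`, the product of the binomial coefficient with two factorials of numbers below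
-- `p`, and it divides neither factorial.
prime∣C : ∀ {p k} → Prime p → 0 < k → k < p → p ∣ p choose k
prime∣C {p@(suc p-1)} {k@(suc k-1)} p-prime _ k<p with euclidsLemma (p choose k) (k ! * (p ∸ k) !) p-prime p∣p!
  where
  k![p-k]!∣p! : k ! * (p ∸ k) ! ∣ p !
  k![p-k]!∣p! = k![n∸k]!∣n! (<⇒≤ k<p)
  p! : p ! ≡ (p choose k) * (k ! * (p ∸ k) !)
  p! = trans (m∣n⇒n≡quotient*m k![p-k]!∣p!) (cong (λ c → c * (k ! * (p ∸ k) !))
    (trans (sym (n/m≡quotient k![p-k]!∣p! {{k !* (p ∸ k) !≢0}})) (sym (nCk≡n!/k![n-k]! (<⇒≤ k<p)))))
  p∣p! : p ∣ (p choose k) * (k ! * (p ∸ k) !)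
  p∣p! = subst (p ∣_) p! (m∣m*n (p-1 !))
... | inj₁ p∣C = p∣C
... | inj₂ p∣k![p-k]! with euclidsLemma (k !) ((p ∸ k) !) p-prime p∣k![p-k]!
...   | inj₁ p∣k!     = contradiction p∣k! (prime∤! p-prime k<p)
...   | inj₂ p∣[p-k]! = contradiction p∣[p-k]! (prime∤! p-prime (s≤s (m∸n≤m p-1 k-1)))

[1+a]^p : ∀ {p} → Prime p → ∀ a → ∃[ k ] (1 + a) ^ p ≡ 1 + a ^ p + k * p
[1+a]^p {zero} p-prime = contradiction p-prime ¬prime[0]
[1+a]^p {p@(suc p-1)} p-prime a = quotient p∣middle , (begin
  -- With `a` written first, term `k` carries `a ^ k`: the first term is 1, the last is `a ^ p`, and
  -- `p` divides all those between.
  (1 + a) ^ p                             ≡⟨ cong (_^ p) (+-comm 1 a) ⟩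
  (a + 1) ^ p                             ≡⟨ ^′≡^ (a + 1) p ⟨
  (a + 1) ^′ p                            ≡⟨ binomial-theorem p a 1 ⟩
  t Fin.zero + sum (tail t)               ≡⟨ cong₂ _+_ first (sum-init-last (tail t)) ⟩
  1 + (sum (init (tail t)) + last (tail t)) ≡⟨ cong₂ (λ x y → 1 + (x + y)) (m∣n⇒n≡quotient*m p∣middle) final ⟩
  1 + (quotient p∣middle * p + a ^ p)     ≡⟨ cong suc (+-comm _ (a ^ p)) ⟩
  1 + a ^ p + quotient p∣middle * p       ∎)
  where
  open ≡-Reasoning
  t : Vector ℕ (suc p)
  t = binomialTerm a 1 p
  1^ : ∀ n → 1 ^′ n ≡ 1
  1^ n = trans (^′≡^ 1 n) (^-zeroˡ n)
  first : t Fin.zero ≡ 1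
  first = trans (+-identityʳ _) (trans (+-identityʳ _) (1^ p))
  final : last (tail t) ≡ a ^ p
  final = begin
    (p choose suc (toℕ (fromℕ p-1))) ×′ (a ^′ suc (toℕ (fromℕ p-1)) * 1 ^′ (p-1 ∸ toℕ (fromℕ p-1)))
      ≡⟨ cong (λ k → (p choose suc k) ×′ (a ^′ suc k * 1 ^′ (p-1 ∸ k))) (toℕ-fromℕ p-1) ⟩
    (p choose p) ×′ (a ^′ p * 1 ^′ (p-1 ∸ p-1)) ≡⟨ cong₂ (λ x y → x ×′ (a ^′ p * y)) (nCn≡1 p) (1^ (p-1 ∸ p-1)) ⟩
    1 ×′ (a ^′ p * 1)                     ≡⟨ +-identityʳ _ ⟩
    a ^′ p * 1                            ≡⟨ *-identityʳ _ ⟩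
    a ^′ p                                ≡⟨ ^′≡^ a p ⟩
    a ^ p                                 ∎
  p∣middle : p ∣ sum (init (tail t))
  p∣middle = ∣-sum (init (tail t)) λ i →
    subst (p ∣_) (sym (×′≡* (p choose suc (toℕ (inject₁ i))) _))
      (∣m⇒∣m*n _ (prime∣C p-prime z<s (s<s (subst (_< p-1) (sym (toℕ-inject₁ i)) (toℕ<n i)))))

-- Induction on `a`: by `[1+a]^p`, replacing `a` by `1 + a` adds 1 to both sides modulo `p`.
fermat : ∀ {p} → Prime p → ∀ a → ∃[ k ] a ^ p ≡ a + k * p
fermat {zero}  p-prime zero = contradiction p-prime ¬prime[0]
fermat {suc _} p-prime zero = 0 , refl
fermat {p} p-prime (suc a) with k , eqₖ ← fermat p-prime a | l , eqₗ ← [1+a]^p p-prime a =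
  k + l , trans eqₗ (trans (cong (λ x → 1 + x + l * p) eqₖ) (collect a k l p))
  where
  collect : ∀ a k l p → 1 + (a + k * p) + l * p ≡ suc a + (k + l) * p
  collect = solve-∀

prime∧∤⇒coprime : ∀ {p n} → Prime p → p ∤ n → Coprime p n
prime∧∤⇒coprime p-prime p∤n (d∣p , d∣n) with prime⇒irreducible p-prime d∣p
... | inj₁ d≡1  = d≡1
... | inj₂ refl = contradiction d∣n p∤n

fermat-coprime : ∀ {p b} .{{_ : NonZero b}} → Prime (suc p) → Coprime (suc p) b → b ^ p ≡1[mod suc p ]
fermat-coprime {p} {b} p-prime p⊥b with k , eq ← fermat p-prime b =
  ≡1-cancelˡ 0 k {{m^n≢0 b p}} p⊥b (trans (+-identityʳ _) eq)

-- Orders modulo safe primes.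

-- If `q - 1` were odd, the prime `q` would be 2 and the halved number 0, which is not prime.
safePrime-odd : ∀ {q} → Prime q → Prime ((q ∸ 1) ℕ./ 2) → q ≡ 1 + (q ∸ 1) ℕ./ 2 * 2
safePrime-odd {zero} q-prime _ = contradiction q-prime ¬prime[0]
safePrime-odd {suc m} q-prime h-prime with m % 2 | m≡m%n+[m/n]*n m 2 | m%n<n m 2
... | 0 | m≡ | _ = cong suc m≡
... | suc (suc _) | _ | s≤s (s≤s ())
... | 1 | m≡ | _ with prime⇒irreducible q-prime 2∣1+m
  where
  2∣1+m : 2 ∣ suc m
  2∣1+m = divides (suc (m ℕ./ 2)) (cong suc m≡)
...   | inj₂ refl = contradiction h-prime ¬prime[0]

≡1-cancel : ∀ {s x y} .{{_ : NonZero y}} → x ≡1[mod s ] → x * y ≡1[mod s ] → y ≡1[mod s ]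
≡1-cancel {s} (l , refl) (k , eq) = ≡1-cancelˡ l k (Coprimality.sym (coprime-1+* l s))
  (trans (cong (_+ l * s) eq) (exchange (k * s) (l * s)))
  where
  exchange : ∀ x y → 1 + x + y ≡ 1 + y + x
  exchange = solve-∀

-- The exponents that send `b` to 1 are closed under integer combinations; `e = m x - n y` is
-- written additively to match the Bézout identities in ℕ.
≡1-exponents : ∀ {s b m n e} .{{_ : NonZero b}} x y → b ^ m ≡1[mod s ] → b ^ n ≡1[mod s ] →
               m * x ≡ n * y + e → b ^ e ≡1[mod s ]
≡1-exponents {s} {b} {m} {n} {e} x y bᵐ≡1 bⁿ≡1 eq =
  ≡1-cancel {{m^n≢0 b e}} (≡1-^ y bⁿ≡1) (subst (_≡1[mod s ]) power (≡1-^ x bᵐ≡1))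
  where
  open ≡-Reasoning
  power : (b ^ m) ^ x ≡ (b ^ n) ^ y * b ^ e
  power = begin
    (b ^ m) ^ x           ≡⟨ ^-*-assoc b m x ⟩
    b ^ (m * x)           ≡⟨ cong (b ^_) eq ⟩
    b ^ (n * y + e)       ≡⟨ ^-distribˡ-+-* b (n * y) e ⟩
    b ^ (n * y) * b ^ e   ≡⟨ cong (_* b ^ e) (^-*-assoc b n y) ⟨
    (b ^ n) ^ y * b ^ e   ∎

-- If `d < h`, then `d` is coprime to the prime `h`, which makes 2 a combination of `d` and `2h`;
-- hence b^2 ≡ 1 and q < b^2. Otherwise q = 1 + 2h <= 3d. The constant `b * b + 3` covers both
-- cases.
safePrime-order : ∀ {h b d} → 1 < b → Prime h → Prime (1 + h * 2) → Coprime (1 + h * 2) b →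
                  1 ≤ d → b ^ d ≡1[mod 1 + h * 2 ] → 1 + h * 2 ≤ (b * b + 3) * d
safePrime-order {h} {b} {d@(suc _)} 1<b h-prime q-prime q⊥b 1≤d bᵈ≡1 with d <? h
... | no d≮h = begin
  1 + h * 2         ≤⟨ +-mono-≤ 1≤d (*-monoˡ-≤ 2 (≮⇒≥ d≮h)) ⟩
  d + d * 2         ≡⟨ cong (_+_ d) (*-comm d 2) ⟩
  3 * d             ≤⟨ *-monoˡ-≤ d (m≤n+m 3 (b * b)) ⟩
  (b * b + 3) * d   ∎
  where open ≤-Reasoning
... | yes d<h = begin
  1 + h * 2         ≤⟨ <⇒≤ (≡1⇒< (*-mono-< 1<b 1<b) b²≡1) ⟩
  b * b             ≤⟨ m≤m+n (b * b) 3 ⟩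
  b * b + 3         ≤⟨ m≤m*n (b * b + 3) d ⟩
  (b * b + 3) * d   ∎
  where
  open ≤-Reasoning
  q = 1 + h * 2
  instance
    b≢0 : NonZero b
    b≢0 = >-nonZero (<-trans z<s 1<b)
  b²ʰ≡1 : b ^ (h * 2) ≡1[mod q ]
  b²ʰ≡1 = fermat-coprime q-prime q⊥b
  double : ∀ h x → x * h * 2 ≡ h * 2 * x
  double = solve-∀
  double′ : ∀ d y → y * d * 2 ≡ d * (y * 2)
  double′ = solve-∀
  double-suc : ∀ d y → (1 + y * d) * 2 ≡ d * (y * 2) + 2
  double-suc = solve-∀
  double-suc′ : ∀ h x → (1 + x * h) * 2 ≡ h * 2 * x + 2
  double-suc′ = solve-∀
  b²≡1 : b * b ≡1[mod q ]
  b²≡1 with Coprimality.coprime-Bézout (Coprimality.prime⇒coprime h-prime d<h)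
  -- Doubling `1 + y d = x h` gives `2h x = d (2y) + 2`, so the exponent left over is 2.
  ... | Bézout.+- x y 1+yd≡xh = subst (_≡1[mod q ]) (cong (b *_) (*-identityʳ b))
    (≡1-exponents {b = b} {m = h * 2} {n = d} x (y * 2) b²ʰ≡1 bᵈ≡1
      (trans (sym (double h x)) (trans (cong (_* 2) (sym 1+yd≡xh)) (double-suc d y))))
  ... | Bézout.-+ x y 1+xh≡yd = subst (_≡1[mod q ]) (cong (b *_) (*-identityʳ b))
    (≡1-exponents {b = b} {m = d} {n = h * 2} (y * 2) x bᵈ≡1 b²ʰ≡1
      (trans (sym (double′ d y)) (trans (cong (_* 2) (sym 1+xh≡yd)) (double-suc′ h x))))

-- Short orders against a linear lower bound.

-- Both `a ^ n * (a + n)` and the bound on `d` contain the factor `a ^ n`. Cancelling it leaves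
-- `n <= a * (suc a * K)`, which is free of `s`.
exponential-bound : ∀ {a s K} .{{_ : NonZero a}} .{{_ : NonZero s}} →
  (∀ n → s < suc a ^ n → ∃[ d ] 1 ≤ d × d ≤ a ^ n × suc a ^ d ≡1[mod s ]) →
  (∀ d → 1 ≤ d → suc a ^ d ≡1[mod s ] → s ≤ K * d) →
  s ≤ suc a ^ (a * (suc a * K))
exponential-bound {a} {s} {K} short linear
  with n , s<bⁿ , bⁿ≤bs ← <-power (suc a) s (s≤s (>-nonZero⁻¹ a))
  with d , 1≤d , d≤aⁿ , bᵈ≡1 ← short n s<bⁿ =
  ≤-trans (<⇒≤ s<bⁿ) (^-monoʳ-≤ (suc a) (≤-trans (m≤n+m n a) a+n≤))
  where
  open ≤-Reasoning
  rearrange : ∀ a b K x → a * (b * (K * x)) ≡ x * (a * (b * K))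
  rearrange = solve-∀
  a+n≤ : a + n ≤ a * (suc a * K)
  a+n≤ = *-cancelˡ-≤ (a ^ n) {{m^n≢0 a n}} (begin
    a ^ n * (a + n)               ≤⟨ bernoulli a n ⟩
    a * suc a ^ n                 ≤⟨ *-monoʳ-≤ a bⁿ≤bs ⟩
    a * (suc a * s)               ≤⟨ *-monoʳ-≤ a (*-monoʳ-≤ (suc a) (linear d 1≤d bᵈ≡1)) ⟩
    a * (suc a * (K * d))         ≤⟨ *-monoʳ-≤ a (*-monoʳ-≤ (suc a) (*-monoʳ-≤ K d≤aⁿ)) ⟩
    a * (suc a * (K * a ^ n))     ≡⟨ rearrange a (suc a) K (a ^ n) ⟩
    a ^ n * (a * (suc a * K))     ∎)

-- Digit windows and the order of `b` modulo `s`.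

-- The first `n` digits read as a base `b` integer, that is, `b ^ n` times the `n`-th partial sum.
prefix : ∀ {b} → (ℕ → Fin b) → ℕ → ℕ
prefix     w zero    = 0
prefix {b} w (suc n) = b * prefix w n + toℕ (w n)

prefix-+ : ∀ {b} (w : ℕ → Fin b) i n →
           prefix w (i + n) ≡ b ^ n * prefix w i + prefix (w ∘ _+_ i) n
prefix-+ {b} w i zero = trans (cong (prefix w) (+-identityʳ i))
  (sym (trans (+-identityʳ _) (*-identityˡ _)))
prefix-+ {b} w i (suc n) = trans (cong (prefix w) (+-suc i n))
  (trans (cong (λ x → b * x + toℕ (w (i + n))) (prefix-+ w i n)) (expand b (b ^ n) (prefix w i) _ _))
  where
  expand : ∀ b x p v t → b * (x * p + v) + t ≡ b * x * p + (b * v + t)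
  expand = solve-∀

prefix-cong : ∀ {b} {v w : ℕ → Fin b} n → (∀ k → k < n → v k ≡ w k) → prefix v n ≡ prefix w n
prefix-cong zero    _   = refl
prefix-cong {b} (suc n) v≗w =
  cong₂ (λ x y → b * x + toℕ y) (prefix-cong n (λ k → v≗w k ∘ m<n⇒m<1+n)) (v≗w n ≤-refl)

-- Here `B m >= v` and `B n < v + B`, whereas `m < n` would put the two multiples of `B` at least
-- `B` apart.
scaled-≮ : ∀ {B x y m n} v → x + v ≡ B * m → y + v ≡ B * n → y < B → m ≮ n
scaled-≮ {B} {x} {y} {m} {n} v eqₘ eqₙ y<B m<n = <-irrefl refl (begin-strict
  B + B * m   ≡⟨ *-suc B m ⟨
  B * suc m   ≤⟨ *-monoʳ-≤ B m<n ⟩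
  B * n       ≡⟨ eqₙ ⟨
  y + v       <⟨ +-monoˡ-< v y<B ⟩
  B + v       ≤⟨ +-monoʳ-≤ B (m≤n+m v x) ⟩
  B + (x + v) ≡⟨ cong (_+_ B) eqₘ ⟩
  B + B * m   ∎)
  where open ≤-Reasoning

-- `c` is the missing digit; `lower` and `upper` enclose `r / s` between consecutive multiples of
-- b^(-j), with denominators cleared.
module _ {a} (w : ℕ → Fin (suc a)) (c : Fin (suc a)) (c≢w : ∀ j → c ≢ w j)
         {r s} (s⊥b : Coprime s (suc a)) (s⊥r : Coprime s r)
         (lower : ∀ j → prefix w j * s ≤ r * suc a ^ j)
         (upper : ∀ j → r * suc a ^ j ≤ suc (prefix w j) * s)
  where

  private
    b = suc a

    -- `m j / s` is the value of the expansion shifted by `j` digits; `lower` makes the truncated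
    -- subtraction exact.
    m : ℕ → ℕ
    m j = r * b ^ j ∸ prefix w j * s

    m-spec : ∀ j → m j + prefix w j * s ≡ r * b ^ j
    m-spec j = m∸n+n≡m (lower j)

    m≤s : ∀ j → m j ≤ s
    m≤s j = m≤n+o⇒m∸n≤o (r * b ^ j) (prefix w j * s)
      (subst (r * b ^ j ≤_) (+-comm s (prefix w j * s)) (upper j))

    -- Multiplying `m i / s` by `b ^ n` moves the next `n` digits in front of the point, where they
    -- form an integer.
    m-shift : ∀ i n → m (i + n) + prefix (w ∘ _+_ i) n * s ≡ b ^ n * m i
    m-shift i n = +-cancelʳ-≡ (b ^ n * prefix w i * s) _ _ (begin
      m (i + n) + v * s + b ^ n * p * s   ≡⟨ regroup (m (i + n)) v s (b ^ n) p ⟩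
      m (i + n) + (b ^ n * p + v) * s     ≡⟨ cong (λ x → m (i + n) + x * s) (prefix-+ w i n) ⟨
      m (i + n) + prefix w (i + n) * s    ≡⟨ m-spec (i + n) ⟩
      r * b ^ (i + n)                     ≡⟨ cong (r *_) (^-distribˡ-+-* b i n) ⟩
      r * (b ^ i * b ^ n)                 ≡⟨ pull r (b ^ i) (b ^ n) ⟩
      b ^ n * (r * b ^ i)                 ≡⟨ cong (b ^ n *_) (m-spec i) ⟨
      b ^ n * (m i + p * s)               ≡⟨ expand (b ^ n) (m i) p s ⟩
      b ^ n * m i + b ^ n * p * s         ∎)
      where
      open ≡-Reasoning
      p = prefix w i
      v = prefix (w ∘ _+_ i) n
      regroup : ∀ y v s x p → y + v * s + x * p * s ≡ y + (x * p + v) * s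
      regroup = solve-∀
      pull : ∀ r x y → r * (x * y) ≡ y * (r * x)
      pull = solve-∀
      expand : ∀ x y p s → x * (y + p * s) ≡ x * y + x * p * s
      expand = solve-∀

    -- With `v` the common window value, `b ^ n * m i` and `b ^ n * m j` both lie in [v s, v s + s],
    -- an interval too short for two multiples of `b ^ n`. Tails may equal 1, so `s < b ^ n` must be
    -- strict.
    m-determined : ∀ i j n → s < b ^ n → (∀ k → k < n → w (i + k) ≡ w (j + k)) → m i ≡ m j
    m-determined i j n s<bⁿ same = ≤-antisym
      (≮⇒≥ (scaled-≮ (v * s) eqⱼ (m-shift i n) (≤-<-trans (m≤s (i + n)) s<bⁿ)))
      (≮⇒≥ (scaled-≮ (v * s) (m-shift i n) eqⱼ (≤-<-trans (m≤s (j + n)) s<bⁿ)))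
      where
      v = prefix (w ∘ _+_ i) n
      eqⱼ : m (j + n) + v * s ≡ b ^ n * m j
      eqⱼ = trans (cong (λ x → m (j + n) + x * s) (prefix-cong n same)) (m-shift j n)

  -- Two of the positions 0, ..., `a ^ n` start equal windows and so have equal `m`. Thus r b^i ≡ r
  -- b^j modulo `s`, and `r * b ^ i` is cancelled.
  short-order : ∀ n → s < b ^ n → ∃[ d ] 1 ≤ d × d ≤ a ^ n × b ^ d ≡1[mod s ]
  short-order n s<bⁿ with pigeonhole (n<1+n (a ^ n)) (λ i → funToFin (window (toℕ i)))
    where
    window : ℕ → Fin n → Fin a
    -- Removing the value `c` codes each digit in `Fin a`, which reduces the count of windows from
    -- b^n to `a ^ n`.
    window i k = punchOut (c≢w (i + toℕ k))
  ... | i , j , i<j , eq =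
    toℕ j ∸ toℕ i , m<n⇒0<n∸m i<j , ≤-trans (m∸n≤m (toℕ j) (toℕ i)) (toℕ≤pred[n] j) ,
    ≡1-cancelˡ (prefix w (toℕ i)) (prefix w (toℕ j)) {{m^n≢0 b (toℕ j ∸ toℕ i)}}
      (coprime-* s⊥r (coprime-^ (toℕ i) s⊥b)) (begin
        r * b ^ toℕ i * b ^ (toℕ j ∸ toℕ i) + pᵢ * s   ≡⟨ cong (_+ pᵢ * s) (*-assoc r _ _) ⟩
        r * (b ^ toℕ i * b ^ (toℕ j ∸ toℕ i)) + pᵢ * s ≡⟨ cong (λ x → r * x + pᵢ * s) (^-distribˡ-+-* b (toℕ i) _) ⟨
        r * b ^ (toℕ i + (toℕ j ∸ toℕ i)) + pᵢ * s     ≡⟨ cong (λ x → r * b ^ x + pᵢ * s) (m+[n∸m]≡n (<⇒≤ i<j)) ⟩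
        r * b ^ toℕ j + pᵢ * s                         ≡⟨ cong (_+ pᵢ * s) (m-spec (toℕ j)) ⟨
        m (toℕ j) + pⱼ * s + pᵢ * s
          ≡⟨ cong (λ x → x + pⱼ * s + pᵢ * s) (m-determined (toℕ i) (toℕ j) n s<bⁿ same) ⟨
        m (toℕ i) + pⱼ * s + pᵢ * s                    ≡⟨ exchange (m (toℕ i)) (pⱼ * s) (pᵢ * s) ⟩
        m (toℕ i) + pᵢ * s + pⱼ * s                    ≡⟨ cong (_+ pⱼ * s) (m-spec (toℕ i)) ⟩
        r * b ^ toℕ i + pⱼ * s                         ∎)
    where
    open ≡-Reasoning
    pᵢ = prefix w (toℕ i)
    pⱼ = prefix w (toℕ j)
    exchange : ∀ x y z → x + y + z ≡ x + z + y
    exchange = solve-∀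
    same : ∀ k → k < n → w (toℕ i + k) ≡ w (toℕ j + k)
    same k k<n = subst (λ k → w (toℕ i + k) ≡ w (toℕ j + k)) (toℕ-fromℕ< k<n)
      (punchOut-injective (c≢w _) (c≢w _)
        (trans (sym (finToFun-funToFin _ (fromℕ< k<n)))
          (trans (cong (λ x → finToFun x (fromℕ< k<n)) eq) (finToFun-funToFin _ (fromℕ< k<n)))))

-- Fractions compared and added through natural numbers.

toℚᵘ-/ : ∀ i n .{{_ : NonZero n}} → toℚᵘ (i / n) ℚᵘ.≃ mkℚᵘ i (pred n)
toℚᵘ-/ i (suc n) = ℚ.toℚᵘ-fromℚᵘ (mkℚᵘ i n)

/-mono-≤ : ∀ i j m n .{{_ : NonZero m}} .{{_ : NonZero n}} →
           i * n ≤ j * m → (+ i) / m ℚ.≤ (+ j) / n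
/-mono-≤ i j m@(suc _) n@(suc _) in≤jm = ℚ.toℚᵘ-cancel-≤ (begin
  toℚᵘ (+ i / m)        ≃⟨ toℚᵘ-/ (+ i) m ⟩
  mkℚᵘ (+ i) (pred m) ≤⟨ *≤* (subst₂ ℤ._≤_ (ℤ.pos-* i n) (ℤ.pos-* j m) (+≤+ in≤jm)) ⟩
  mkℚᵘ (+ j) (pred n) ≃⟨ toℚᵘ-/ (+ j) n ⟨
  toℚᵘ (+ j / n)        ∎)
  where open ℚᵘ.≤-Reasoning

/-cancel-≤ : ∀ i j m n .{{_ : NonZero m}} .{{_ : NonZero n}} →
             (+ i) / m ℚ.≤ (+ j) / n → i * n ≤ j * m
/-cancel-≤ i j m@(suc m-1) n@(suc n-1) i/m≤j/n =
  ℤ.drop‿+≤+ (subst₂ ℤ._≤_ (sym (ℤ.pos-* i n)) (sym (ℤ.pos-* j m)) (ℚᵘ.drop-*≤* (begin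
    mkℚᵘ (+ i) m-1 ≃⟨ toℚᵘ-/ (+ i) m ⟨
    toℚᵘ (+ i / m) ≤⟨ ℚ.toℚᵘ-mono-≤ i/m≤j/n ⟩
    toℚᵘ (+ j / n) ≃⟨ toℚᵘ-/ (+ j) n ⟩
    mkℚᵘ (+ j) n-1 ∎)))
  where open ℚᵘ.≤-Reasoning

-- The shape that arises when a digit is appended to a partial sum: the old denominator divides the
-- new one.
/-+-/ : ∀ i j m k .{{_ : NonZero m}} .{{_ : NonZero (k * m)}} →
        (+ i) / m ℚ.+ (+ j) / (k * m) ≡ (+ (k * i + j)) / (k * m)
/-+-/ i j m@(suc _) k@(suc _) = ℚ.toℚᵘ-injective (begin
  toℚᵘ (+ i / m ℚ.+ + j / (k * m))          ≈⟨ ℚ.toℚᵘ-homo-+ (+ i / m) (+ j / (k * m)) ⟩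
  toℚᵘ (+ i / m) ℚᵘ.+ toℚᵘ (+ j / (k * m))  ≈⟨ ℚᵘ.+-cong (toℚᵘ-/ (+ i) m) (toℚᵘ-/ (+ j) (k * m)) ⟩
  mkℚᵘ (+ i) (pred m) ℚᵘ.+ mkℚᵘ (+ j) (pred (k * m)) ≈⟨ *≡* cross ⟩
  mkℚᵘ (+ (k * i + j)) (pred (k * m)) ≈⟨ toℚᵘ-/ (+ (k * i + j)) (k * m) ⟨
  toℚᵘ (+ (k * i + j) / (k * m))        ∎)
  where
  open import Relation.Binary.Reasoning.Setoid ℚᵘ.≃-setoid
  cross-ℕ : ∀ i j m k → (i * (k * m) + j * m) * (k * m) ≡ (k * i + j) * (m * (k * m))
  cross-ℕ = solve-∀
  cross : (+ i ℤ.* + (k * m) ℤ.+ + j ℤ.* + m) ℤ.* + (k * m) ≡ + (k * i + j) ℤ.* + (m * (k * m))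
  cross = trans (cong₂ (λ x y → (x ℤ.+ y) ℤ.* + (k * m)) (sym (ℤ.pos-* i (k * m))) (sym (ℤ.pos-* j m)))
    (trans (sym (ℤ.pos-* (i * (k * m) + j * m) (k * m)))
      (trans (cong +_ (cross-ℕ i j m k)) (ℤ.pos-* (k * i + j) (m * (k * m)))))



-- Limits of rational sequences.

∣p-q∣≡∣q-p∣ : ∀ p q → ℚ.∣ p ℚ.- q ∣ ≡ ℚ.∣ q ℚ.- p ∣
∣p-q∣≡∣q-p∣ p q = trans (sym (ℚ.∣-p∣≡∣p∣ (p ℚ.- q))) (cong ℚ.∣_∣ (⁻¹-anti-homo-// p q))

p≤q⇒q-p≤∣q-p∣ : ∀ {p q} → p ℚ.≤ q → q ℚ.- p ℚ.≤ ℚ.∣ q ℚ.- p ∣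
p≤q⇒q-p≤∣q-p∣ {p} {q} p≤q = ℚ.≤-reflexive (sym (ℚ.0≤p⇒∣p∣≡p
  (subst (ℚ._≤ q ℚ.- p) (ℚ.+-inverseʳ p) (ℚ.+-monoˡ-≤ (ℚ.- p) p≤q))))

p<q⇒0<q-p : ∀ {p q} → p ℚ.< q → 0ℚ ℚ.< q ℚ.- p
p<q⇒0<q-p {p} {q} p<q = subst (ℚ._< q ℚ.- p) (ℚ.+-inverseʳ p) (ℚ.+-monoˡ-< (ℚ.- p) p<q)

¬bounded-away : ∀ {u x ε} N → ConvergesTo u x → 0ℚ ℚ.< ε → (∀ n → N ≤ n → ε ℚ.≤ ℚ.∣ u n ℚ.- x ∣) → ⊥
¬bounded-away N u→x 0<ε away with M , close ← u→x _ 0<ε =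
  ℚ.<-irrefl refl (ℚ.<-≤-trans (close (M ⊔ N) (m≤m⊔n M N)) (away (M ⊔ N) (m≤n⊔m M N)))

-- If `y < x`, all terms from `N` on keep the positive distance `x - y` from the limit.
limit-≤ : ∀ {u x y} N → ConvergesTo u x → (∀ n → N ≤ n → u n ℚ.≤ y) → x ℚ.≤ y
limit-≤ {u} {x} {y} N u→x u≤y = ℚ.≮⇒≥ λ y<x → ¬bounded-away {u} {x} N u→x (p<q⇒0<q-p y<x) λ n N≤n → begin
  x ℚ.- y       ≤⟨ ℚ.+-monoʳ-≤ x (ℚ.neg-antimono-≤ (u≤y n N≤n)) ⟩
  x ℚ.- u n     ≤⟨ p≤q⇒q-p≤∣q-p∣ (ℚ.≤-trans (u≤y n N≤n) (ℚ.<⇒≤ y<x)) ⟩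
  ℚ.∣ x ℚ.- u n ∣ ≡⟨ ∣p-q∣≡∣q-p∣ x (u n) ⟩
  ℚ.∣ u n ℚ.- x ∣ ∎
  where open ℚ.≤-Reasoning

limit-≥ : ∀ {u x y} N → ConvergesTo u x → (∀ n → N ≤ n → y ℚ.≤ u n) → y ℚ.≤ x
limit-≥ {u} {x} {y} N u→x y≤u = ℚ.≮⇒≥ λ x<y → ¬bounded-away {u} {x} N u→x (p<q⇒0<q-p x<y) λ n N≤n → begin
  y ℚ.- x       ≤⟨ ℚ.+-monoˡ-≤ (ℚ.- x) (y≤u n N≤n) ⟩
  u n ℚ.- x     ≤⟨ p≤q⇒q-p≤∣q-p∣ (ℚ.≤-trans (ℚ.<⇒≤ x<y) (y≤u n N≤n)) ⟩
  ℚ.∣ u n ℚ.- x ∣ ∎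
  where open ℚ.≤-Reasoning


-- Enclosing the limit by its digit prefixes.

partialSum≡ : ∀ {a} (w : ℕ → Fin (suc a)) n →
              partialSum (suc a) w n ≡ _/_ (+ prefix w n) (suc a ^ n) {{m^n≢0 (suc a) n}}
partialSum≡ w zero = refl
partialSum≡ {a} w (suc n) = trans
  (cong (ℚ._+ (_/_ (+ toℕ (w n)) (suc a ^ suc n) {{m^n≢0 (suc a) (suc n)}})) (partialSum≡ w n))
  (/-+-/ (prefix w n) (toℕ (w n)) (suc a ^ n) (suc a) {{m^n≢0 (suc a) n}} {{m^n≢0 (suc a) (suc n)}})

prefix< : ∀ {b} (w : ℕ → Fin b) n → prefix w n < b ^ n
prefix< w zero = s≤s z≤n
prefix< {b} w (suc n) = begin-strict
  b * prefix w n + toℕ (w n) <⟨ +-monoʳ-< (b * prefix w n) (toℕ<n (w n)) ⟩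
  b * prefix w n + b         ≡⟨ +-comm (b * prefix w n) b ⟩
  b + b * prefix w n         ≡⟨ *-suc b (prefix w n) ⟨
  b * suc (prefix w n)       ≤⟨ *-monoʳ-≤ b (prefix< w n) ⟩
  b * b ^ n                  ∎
  where open ≤-Reasoning

module _ {a} (w : ℕ → Fin (suc a)) where

  private
    b = suc a

    -- Partial sums never decrease; denominators are cleared.
    prefix-lower : ∀ {j n} → j ≤ n → prefix w j * b ^ n ≤ prefix w n * b ^ j
    prefix-lower {j} j≤n with k , refl ← m≤n⇒∃[o]m+o≡n j≤n = begin
      prefix w j * b ^ (j + k)      ≡⟨ cong (prefix w j *_) (^-distribˡ-+-* b j k) ⟩
      prefix w j * (b ^ j * b ^ k)  ≡⟨ pull (prefix w j) (b ^ j) (b ^ k) ⟩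
      b ^ k * prefix w j * b ^ j    ≤⟨ *-monoˡ-≤ (b ^ j) (m≤m+n (b ^ k * prefix w j) _) ⟩
      (b ^ k * prefix w j + prefix (w ∘ _+_ j) k) * b ^ j ≡⟨ cong (_* b ^ j) (prefix-+ w j k) ⟨
      prefix w (j + k) * b ^ j      ∎
      where
      open ≤-Reasoning
      pull : ∀ p x y → p * (x * y) ≡ y * p * x
      pull = solve-∀

    -- The digits from index `j` on add at most b^(-j), by `prefix<`.
    prefix-upper : ∀ {j n} → j ≤ n → prefix w n * b ^ j ≤ suc (prefix w j) * b ^ n
    prefix-upper {j} j≤n with k , refl ← m≤n⇒∃[o]m+o≡n j≤n = begin
      prefix w (j + k) * b ^ j      ≡⟨ cong (_* b ^ j) (prefix-+ w j k) ⟩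
      (b ^ k * prefix w j + prefix (w ∘ _+_ j) k) * b ^ j
        ≤⟨ *-monoˡ-≤ (b ^ j) (+-monoʳ-≤ (b ^ k * prefix w j) (<⇒≤ (prefix< (w ∘ _+_ j) k))) ⟩
      (b ^ k * prefix w j + b ^ k) * b ^ j ≡⟨ pull (prefix w j) (b ^ j) (b ^ k) ⟩
      suc (prefix w j) * (b ^ j * b ^ k)   ≡⟨ cong (suc (prefix w j) *_) (^-distribˡ-+-* b j k) ⟨
      suc (prefix w j) * b ^ (j + k) ∎
      where
      open ≤-Reasoning
      pull : ∀ p x y → (y * p + y) * x ≡ suc p * (x * y)
      pull = solve-∀

  module _ {x} (converges : ConvergesTo (partialSum b w) x) where

    expansion-lower : ∀ j → _/_ (+ prefix w j) (b ^ j) {{m^n≢0 b j}} ℚ.≤ x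
    expansion-lower j = limit-≥ j converges λ n j≤n →
      subst (_/_ (+ prefix w j) (b ^ j) {{m^n≢0 b j}} ℚ.≤_) (sym (partialSum≡ w n))
        (/-mono-≤ (prefix w j) (prefix w n) (b ^ j) (b ^ n) {{m^n≢0 b j}} {{m^n≢0 b n}} (prefix-lower j≤n))

    expansion-upper : ∀ j → x ℚ.≤ _/_ (+ suc (prefix w j)) (b ^ j) {{m^n≢0 b j}}
    expansion-upper j = limit-≤ j converges λ n j≤n →
      subst (ℚ._≤ _/_ (+ suc (prefix w j)) (b ^ j) {{m^n≢0 b j}}) (sym (partialSum≡ w n))
        (/-mono-≤ (prefix w n) (suc (prefix w j)) (b ^ n) (b ^ j) {{m^n≢0 b n}} {{m^n≢0 b j}} (prefix-upper j≤n))

-- Bounded denominators and finiteness.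

0≤-fraction : ∀ x → 0ℚ ℚ.≤ x → ∃[ r ] Coprime r (↧ₙ x) × x ≡ (+ r) / ↧ₙ x
0≤-fraction x@(mkℚ (+ r) _ r⊥s) _ = r , Coprimality.recompute r⊥s , sym (ℚ.↥p/↧p≡p x)
0≤-fraction (mkℚ -[1+ _ ] _ _) (ℚ.*≤* ())

C⇒0≤ : ∀ {a W x} → C (suc a) W x → 0ℚ ℚ.≤ x
-- At `j = 0` the prefix is empty and the enclosing interval is [0, 1].
C⇒0≤ (w , _ , converges) = expansion-lower w converges 0

C⇒≤1 : ∀ {a W x} → C (suc a) W x → x ℚ.≤ 1ℚ
C⇒≤1 (w , _ , converges) = expansion-upper w converges 0

-- The common core of the three finiteness results: each family only has to supply its linear bound,
-- with `K` independent of `x`.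
denominator-bound : ∀ {a W c x K} .{{_ : NonZero a}} → c ∉ˢ W → C (suc a) W x → Coprime (↧ₙ x) (suc a) →
                    (∀ d → 1 ≤ d → suc a ^ d ≡1[mod ↧ₙ x ] → ↧ₙ x ≤ K * d) →
                    ↧ₙ x ≤ suc a ^ (a * (suc a * K))
denominator-bound {a} {W} {c} {x} {K} c∉W x∈C@(w , w∈W , converges) s⊥b =
  exponential-bound {a} {s} {K} (short-order w c c≢w s⊥b (Coprimality.sym r⊥s) lower upper)
  where
  b = suc a
  s = ↧ₙ x
  fraction = 0≤-fraction x (C⇒0≤ {a} {W} x∈C)
  r = proj₁ fraction
  r⊥s : Coprime r s
  r⊥s = proj₁ (proj₂ fraction)
  x≡r/s : x ≡ (+ r) / s
  x≡r/s = proj₂ (proj₂ fraction)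
  c≢w : ∀ j → c ≢ w j
  c≢w j c≡wⱼ = c∉W (subst (_∈ˢ W) (sym c≡wⱼ) (w∈W j))
  lower : ∀ j → prefix w j * s ≤ r * b ^ j
  lower j = /-cancel-≤ (prefix w j) r (b ^ j) s {{m^n≢0 b j}} {{_}}
    (subst (_/_ (+ prefix w j) (b ^ j) {{m^n≢0 b j}} ℚ.≤_) x≡r/s (expansion-lower w converges j))
  upper : ∀ j → r * b ^ j ≤ suc (prefix w j) * s
  upper j = /-cancel-≤ r (suc (prefix w j)) s (b ^ j) {{_}} {{m^n≢0 b j}}
    (subst (ℚ._≤ _/_ (+ suc (prefix w j)) (b ^ j) {{m^n≢0 b j}}) x≡r/s (expansion-upper w converges j))

finitelyMany-⊆ : ∀ {A : Set} {P Q : Pred A 0ℓ} → (∀ {x} → P x → Q x) → FinitelyMany Q → FinitelyMany P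
finitelyMany-⊆ P⊆Q (xs , Q⊆xs) = xs , λ x Px → Q⊆xs x (P⊆Q Px)

finitelyMany-denominators≤ : ∀ M → FinitelyMany (λ x → 0ℚ ℚ.≤ x × x ℚ.≤ 1ℚ × ↧ₙ x ≤ M)
-- Numerators satisfy `r <= s <= M` because `x <= 1`; the second list holds `s - 1`, so the
-- denominators run from 1 to `M`.
finitelyMany-denominators≤ M = cartesianProductWith fraction (upTo (suc M)) (upTo M) , member
  where
  fraction : ℕ → ℕ → ℚ
  fraction r s-1 = (+ r) / suc s-1
  member : ∀ x → 0ℚ ℚ.≤ x × x ℚ.≤ 1ℚ × ↧ₙ x ≤ M → x ∈ cartesianProductWith fraction (upTo (suc M)) (upTo M)
  member x (0≤x , x≤1 , s≤M) with r , _ , x≡r/s ← 0≤-fraction x 0≤x =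
    subst (_∈ _) (sym x≡r/s) (∈-cartesianProductWith⁺ fraction (∈-upTo⁺ (s≤s r≤M)) (∈-upTo⁺ s≤M))
    where
    r≤M : r ≤ M
    r≤M = ≤-trans (subst₂ _≤_ (*-identityʳ r) (+-identityʳ _)
      (/-cancel-≤ r 1 (↧ₙ x) 1 (subst (ℚ._≤ 1ℚ) x≡r/s x≤1))) s≤M

-- Denominators and their prime factors.

-- Reduction divides out the gcd; this carries conditions on a given denominator over to the reduced
-- one.
↧ₙ-/-∣ : ∀ i n .{{_ : NonZero n}} → ↧ₙ (i / n) ∣ n
↧ₙ-/-∣ i n = divides ℤ.∣ g ∣ (trans (cong ℤ.∣_∣ (sym (ℚ.↧-/ i n)))
  (trans (ℤ.abs-* (ℚ.↧ (i / n)) g) (*-comm (↧ₙ (i / n)) _)))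
  where g = ℤ-gcd.gcd i (+ n)

↧ₙ-^-∣ : ∀ x n → ↧ₙ (x ^ℚ n) ∣ ↧ₙ x ^ n
↧ₙ-^-∣ x zero = ∣-refl
↧ₙ-^-∣ x@record{} (suc n) with x ^ℚ n | ↧ₙ-^-∣ x n
... | y@record{} | ∣^n = ∣-trans (↧ₙ-/-∣ (ℚ.↥ x ℤ.* ℚ.↥ y) (↧ₙ x * ↧ₙ y)) (*-monoʳ-∣ (↧ₙ x) ∣^n)

prime∣^⇒prime∣ : ∀ {p m} → Prime p → ∀ n → p ∣ m ^ n → p ∣ m
prime∣^⇒prime∣ p-prime zero p∣1 = contradiction (subst Prime (∣1⇒≡1 p∣1) p-prime) ¬prime[1]
prime∣^⇒prime∣ {m = m} p-prime (suc n) p∣mⁿ⁺¹ with euclidsLemma m (m ^ n) p-prime p∣mⁿ⁺¹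
... | inj₁ p∣m  = p∣m
... | inj₂ p∣mⁿ = prime∣^⇒prime∣ p-prime n p∣mⁿ

primeDivisor : ∀ {n} → n ≢ 1 → ∃[ p ] Prime p × p ∣ n
primeDivisor {zero}  _   = 2 , prime[2] , 2 ∣0
primeDivisor {suc n} n≢1 with factorise (suc n)
... | record { factors = [] ; isFactorisation = eq } = contradiction eq n≢1
... | record { factors = p ∷ ps ; isFactorisation = eq ; factorsPrime = p-prime ∷ _ } =
  p , p-prime , subst (p ∣_) (sym eq) (m∣m*n (product ps))

noCommonPrime⇒coprime : ∀ {m n} → (∀ p → Prime p → p ∣ m → p ∤ n) → Coprime m n
noCommonPrime⇒coprime no-common {d} (d∣m , d∣n) with d ≟ 1
... | yes d≡1 = d≡1
... | no d≢1 with p , p-prime , p∣d ← primeDivisor d≢1 =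
  contradiction (∣-trans p∣d d∣n) (no-common p p-prime (∣-trans p∣d d∣m))

-- A prime common to `s` and `u` lies in `S`, so it divides both `u` and `product S`. This is the
-- form in which `lifting-the-exponent` uses `S`.
onlyPrimeFactorsIn⇒coprime : ∀ {S s u} → OnlyPrimeFactorsIn S s → Coprime u (product S) → Coprime s u
onlyPrimeFactorsIn⇒coprime only u⊥ΠS = noCommonPrime⇒coprime λ p p-prime p∣s p∣u →
  ¬prime[1] (subst Prime (u⊥ΠS (p∣u , ∈⇒∣product (only p p-prime p∣s))) p-prime)

coprime-product : ∀ {b S} → All Prime S → All (_∤ b) S → Coprime b (product S)
coprime-product [] [] = Coprimality.sym (Coprimality.1-coprimeTo _)
coprime-product (p-prime ∷ primes) (p∤b ∷ S∤b) =
  coprime-* (Coprimality.sym (prime∧∤⇒coprime p-prime p∤b)) (coprime-product primes S∤b)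

-- The three finiteness results.

module _ {a} .{{_ : NonZero a}} {W : Subset (suc a)} {c : Fin (suc a)} (c∉W : c ∉ˢ W) where

  private
    b = suc a

    1<b : 1 < b
    1<b = s≤s (>-nonZero⁻¹ a)

  finitelyMany-bounded : ∀ {P : Pred ℚ 0ℓ} M → (∀ {x} → C b W x → P x → ↧ₙ x ≤ M) →
                         FinitelyMany (λ x → C b W x × P x)
  finitelyMany-bounded M bound = finitelyMany-⊆
    (λ (x∈C , Px) → C⇒0≤ x∈C , C⇒≤1 x∈C , bound x∈C Px) (finitelyMany-denominators≤ M)

  finitelyMany-smooth : ∀ S → All Prime S → All (_∤ b) S →
                        FinitelyMany (λ x → C b W x × OnlyPrimeFactorsIn S (↧ₙ x))
  finitelyMany-smooth S primes S∤b
    with D , 1≤D , k , bᴰ≡ ← power≡1 {b} {product S * product S} {{_}}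
      {{m*n≢0 (product S) (product S) {{productOfPrimes≢0 primes}} {{productOfPrimes≢0 primes}}}}
      (Coprimality.sym (coprime-* (coprime-product primes S∤b) (coprime-product primes S∤b))) =
    finitelyMany-bounded (b ^ (a * (b * (k * (product S * product S))))) bound
    where
    P = product S
    b⊥P : Coprime b P
    b⊥P = coprime-product primes S∤b
    K = k * (P * P)
    K≢0 : NonZero K
    -- `K = 0` would mean `b ^ D = 1` although `D >= 1` and `b > 1`. Nonzero `K` turns `s ∣ K * d`
    -- into a bound on `s`.
    K≢0 = ≢-nonZero λ K≡0 → case m^n≡1⇒n≡0∨m≡1 b D (trans bᴰ≡ (cong suc K≡0)) of λ where
      (inj₁ D≡0) → contradiction (sym D≡0) (<⇒≢ 1≤D)
      (inj₂ b≡1) → contradiction (sym b≡1) (<⇒≢ 1<b)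
    [bᵈ]ᴰ : ∀ d → (b ^ d) ^ D ≡ (1 + K) ^ d
    [bᵈ]ᴰ d = begin
      (b ^ d) ^ D   ≡⟨ ^-*-assoc b d D ⟩
      b ^ (d * D)   ≡⟨ cong (b ^_) (*-comm d D) ⟩
      b ^ (D * d)   ≡⟨ ^-*-assoc b D d ⟨
      (b ^ D) ^ d   ≡⟨ cong (_^ d) bᴰ≡ ⟩
      (1 + K) ^ d   ∎
      where open ≡-Reasoning
    bound : ∀ {x} → C b W x → OnlyPrimeFactorsIn S (↧ₙ x) → ↧ₙ x ≤ b ^ (a * (b * K))
    bound {x} x∈C only = denominator-bound c∉W x∈C (onlyPrimeFactorsIn⇒coprime only b⊥P) λ where
      d@(suc _) _ bᵈ≡1 → ∣⇒≤ {{m*n≢0 K d {{K≢0}}}}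
        (lifting-the-exponent (λ u → onlyPrimeFactorsIn⇒coprime only) d K (n∣m*n k)
          (subst (_≡1[mod ↧ₙ x ]) ([bᵈ]ᴰ d) (≡1-^ D bᵈ≡1)))

  finitelyMany-fractions : ∀ S → All Prime S → All (_∤ b) S →
    FinitelyMany (λ x → C b W x ×
      (Σ[ r ∈ ℤ ] Σ[ s ∈ ℕ ] Σ[ s≢0 ∈ NonZero s ] (OnlyPrimeFactorsIn S s × x ≡ _/_ r s {{s≢0}})))
  finitelyMany-fractions S primes S∤b = finitelyMany-⊆
    (λ where (x∈C , r , s , s≢0 , only , refl) →
               x∈C , λ p p-prime p∣↧ → only p p-prime (∣-trans p∣↧ (↧ₙ-/-∣ r s {{s≢0}})))
    (finitelyMany-smooth S primes S∤b)

  finitelyMany-powers : ∀ p q .{{_ : NonZero q}} → Coprime b q →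
    FinitelyMany (λ x → C b W x × (∃[ n ] (1 ≤ n × x ≡ (p / q) ^ℚ n)))
  finitelyMany-powers p q b⊥q with factorise q
  ... | record { factors = S ; isFactorisation = q≡ΠS ; factorsPrime = primes } = finitelyMany-⊆
    (λ where (x∈C , n , _ , refl) →
               x∈C , λ r r-prime r∣↧ → factorisationHasAllPrimeFactors r-prime (subst (r ∣_) q≡ΠS
                 (∣-trans (prime∣^⇒prime∣ r-prime n (∣-trans r∣↧ (↧ₙ-^-∣ (p / q) n))) (↧ₙ-/-∣ p q))) primes)
    (finitelyMany-smooth S primes (All.tabulate S∤b))
    where
    S∤b : ∀ {r} → r ∈ S → r ∤ b
    S∤b r∈S r∣b = ¬prime[1] (subst Prime
      (b⊥q (r∣b , subst (_ ∣_) (sym q≡ΠS) (∈⇒∣product r∈S))) (All.lookup primes r∈S))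

  finitelyMany-safePrimes : FinitelyMany (λ x → C b W x ×
    (Σ[ p ∈ ℤ ] Σ[ q ∈ ℕ ] Σ[ q≢0 ∈ NonZero q ] (SafePrime q × x ≡ _/_ p q {{q≢0}})))
  -- The order argument needs `q` coprime to `b`. If `q` divides `b`, the denominator is at most
  -- `b`, hence the first summand.
  finitelyMany-safePrimes = finitelyMany-bounded (b + M) λ where
      x∈C (p , q , q≢0 , safe , refl) → bound x∈C q safe (↧ₙ-/-∣ p q {{q≢0}})
    where
    K = b * b + 3
    M = b ^ (a * (b * K))
    linear : ∀ {q} → SafePrime q → Coprime q b → ∀ {s} → s ∣ q →
             ∀ d → 1 ≤ d → b ^ d ≡1[mod s ] → s ≤ K * d
    -- The reduced denominator divides the prime `q`: it is 1, where `K >= 1` suffices, or `q`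
    -- itself.
    linear {q} (q-prime , h-prime) q⊥b s∣q d 1≤d bᵈ≡1 with prime⇒irreducible q-prime s∣q
    ... | inj₁ refl = *-mono-≤ {1} {K} (≤-trans (s≤s z≤n) (m≤n+m 3 (b * b))) 1≤d
    ... | inj₂ refl = subst (_≤ K * d) (sym q≡)
      (safePrime-order 1<b h-prime (subst Prime q≡ q-prime) (subst (λ q → Coprime q b) q≡ q⊥b) 1≤d
        (subst (b ^ d ≡1[mod_]) q≡ bᵈ≡1))
      where
      q≡ : q ≡ 1 + (q ∸ 1) ℕ./ 2 * 2
      q≡ = safePrime-odd q-prime h-prime
    bound : ∀ {x} → C b W x → ∀ q → SafePrime q → ↧ₙ x ∣ q → ↧ₙ x ≤ b + M
    bound {x} x∈C q safe s∣q with q ∣? b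
    ... | yes q∣b = ≤-trans (∣⇒≤ (∣-trans s∣q q∣b)) (m≤m+n b M)
    ... | no q∤b  = ≤-trans
      (denominator-bound c∉W x∈C (λ (d∣s , d∣b) → q⊥b (∣-trans d∣s s∣q , d∣b)) (linear safe q⊥b s∣q))
      (m≤n+m M b)
      where
      q⊥b : Coprime q b
      q⊥b = prime∧∤⇒coprime (proj₁ safe) q∤b

corollary4p4 : (b : ℕ) .{{_ : NonZero b}} → 3 ≤ b →
    (W : Subset b) → W ⊂ ⊤ → 2 ≤ ∣ W ∣ →
    ((S : List ℕ) → All Prime S → All (λ p → p ∤ b) S →
    FinitelyMany (λ (x : ℚ) → C b W x ×
    (Σ[ r ∈ ℤ ] Σ[ s ∈ ℕ ] Σ[ s≢0 ∈ NonZero s ] (OnlyPrimeFactorsIn S s × x ≡ _/_ r s {{s≢0}}))))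
    ×
    ((p : ℤ) (q : ℕ) .{{_ : NonZero q}} → Coprime b q →
    FinitelyMany (λ (x : ℚ) → C b W x × (∃[ n ] (1 ≤ n × x ≡ (p / q) ^ℚ n))))
    ×
    FinitelyMany (λ (x : ℚ) → C b W x ×
    (Σ[ p ∈ ℤ ] Σ[ q ∈ ℕ ] Σ[ q≢0 ∈ NonZero q ] (SafePrime q × x ≡ _/_ p q {{q≢0}})))
-- The strict inclusion in `⊤` provides the missing digit `c`.
corollary4p4 (suc a@(suc _)) (s≤s (s≤s _)) W (_ , c , _ , c∉W) _ =
  finitelyMany-fractions {a} {W} {c} c∉W ,
  (λ p q → finitelyMany-powers {a} {W} {c} c∉W p q) ,
  finitelyMany-safePrimes {a} {W} {c} c∉W
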